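{- Fix $d\ge2$. For finite sets $S\subseteq\mathbb{Z}^d$, $p_{\mathbb{Z}^d}(S)\ge \frac{(1+o(1))|S|}{\ln|S|}$, where $o(1)\to0$ as $|S|\to\infty$.
   Context: $p_{\mathbb{Z}^d}(S)$ is the largest number of colors for which there is a coloring of $\mathbb{Z}^d$ such that every translate $\mathbf{n}+S=\{\mathbf{n}+\mathbf{s}:\mathbf{s}\in S\}$, $\mathbf{n}\in\mathbb{Z}^d$, contains an element of each color. (Known result usable: for finite $S\subseteq\mathbb{Z}$, $p_{\mathbb{Z}}(S)\ge\frac{(1+o(1))|S|}{\ln|S|}$, due to Alon–Kříž–Nešetřil and Harris–Srinivasan.) -}

module Defs where

open import Algebra.Core using (Op₂)
open import Data.Empty using (⊥-elim)
open import Data.Fin using (Fin; zero)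
open import Data.Fin.Properties using (injective⇒≤)
open import Data.Integer as ℤ using (ℤ; +_)
open import Data.List using (List; _∷_; length; foldr; applyUpTo; lookup)
open import Data.List.Membership.Propositional using (_∈_)
open import Data.List.Relation.Unary.Any using (here; index)
open import Data.List.Relation.Unary.Any.Properties using (lookup-index)
open import Data.List.Relation.Unary.Unique.Propositional using (Unique)
open import Data.Nat using (ℕ; zero; suc; _+_; _*_; _∸_; _≤_; _≤?_)
open import Data.Nat.Properties using (≤-trans; m≤m+n; +-suc; +-monoʳ-≤; ≤-reflexive; ≰⇒>)
open import Data.Product using (Σ; _×_; _,_; ∃-syntax; proj₁; proj₂)
open import Data.Rational as ℚ using (ℚ; 0ℚ; 1ℚ; _/_)
open import Data.Vec using (Vec; zipWith)
open import Relation.Binary.PropositionalEquality using (_≡_; refl; sym; trans; cong)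
open import Relation.Nullary using (¬_; yes; no)

ℤ^ : ℕ → Set
ℤ^ d = Vec ℤ d

_+ᵛ_ : ∀ {d} → Op₂ (ℤ^ d)
_+ᵛ_ = zipWith ℤ._+_

module Polychromatic {A : Set} (_∙_ : Op₂ A) where

  -- Every translate n ∙ S contains an element of each of the k colors.
  IsPolychromatic : List A → (k : ℕ) → (A → Fin k) → Set
  IsPolychromatic S k χ = ∀ n (j : Fin k) → ∃[ s ] s ∈ S × χ (n ∙ s) ≡ j

  HasPolychromaticColoring : List A → ℕ → Set
  HasPolychromaticColoring S k = ∃[ χ ] IsPolychromatic S k χ

  -- The graph of S ↦ p(S): no function List A → ℕ computing the maximum is
  -- available constructively.
  IsPolychromaticNumber : List A → ℕ → Set
  IsPolychromaticNumber S p =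
    HasPolychromaticColoring S p × (∀ k → HasPolychromaticColoring S k → k ≤ p)

  coloring≤size : A → ∀ S k → HasPolychromaticColoring S k → k ≤ length S
  coloring≤size a S k (χ , poly) = injective⇒≤ {f = f} f-injective
    where
    f : Fin k → Fin (length S)
    f j = index (proj₁ (proj₂ (poly a j)))

    color-f : ∀ j → χ (a ∙ lookup S (f j)) ≡ j
    color-f j = trans
      (cong (λ s → χ (a ∙ s)) (sym (lookup-index (proj₁ (proj₂ (poly a j))))))
      (proj₂ (proj₂ (poly a j)))

    f-injective : ∀ {i j} → f i ≡ f j → i ≡ j
    f-injective {i} {j} eq = trans (sym (color-f i))
      (trans (cong (λ m → χ (a ∙ lookup S m)) eq) (color-f j))

  -- Existence of the maximum is classical, hence the double negation.
  polychromaticNumber-exists :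
    A → ∀ S → 1 ≤ length S → ¬ ¬ (∃[ p ] IsPolychromaticNumber S p)
  polychromaticNumber-exists a S@(x ∷ _) _ =
    climb (length S) 1 ((λ _ → zero) , λ { _ zero → x , here refl , refl })
      (m≤m+n (length S) 1)
    where
    climb : ∀ fuel k → HasPolychromaticColoring S k → length S ≤ fuel + k →
            ¬ ¬ (∃[ p ] IsPolychromaticNumber S p)
    climb fuel k col bound none = none (k , col , maximal fuel bound)
      where
      maximal : ∀ fuel → length S ≤ fuel + k →
                ∀ k′ → HasPolychromaticColoring S k′ → k′ ≤ k
      maximal fuel bound k′ col′ with k′ ≤? k
      ... | yes k′≤k = k′≤k
      maximal zero bound k′ col′ | no _ =
        ≤-trans (coloring≤size a S k′ col′) bound
      maximal (suc fuel) bound k′ col′ | no k′≰k =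
        ⊥-elim (climb fuel k′ col′
          (≤-trans bound (≤-trans (≤-reflexive (sym (+-suc fuel k)))
                                  (+-monoʳ-≤ fuel (≰⇒> k′≰k)))) none)

-- The left-endpoint Riemann sum of ∫₁ⁿ dt/t on suc k equal subintervals.  With
-- m = suc k and h = (n - 1)/m, the i-th term is
-- h · 1/(1 + i·h) = (n - 1)/(m + i·(n - 1)).
-- As 1/t is decreasing, these are upper sums, with infimum ln n.
lnUpperSum : ℕ → ℕ → ℚ
lnUpperSum n k =
  foldr ℚ._+_ 0ℚ (applyUpTo (λ i → + (n ∸ 1) / (suc k + i * (n ∸ 1))) (suc k))

-- The upper Dedekind cut of ln n, for n ≥ 1.
_>ln_ : ℚ → ℕ → Set
u >ln n = ∃[ k ] lnUpperSum n k ℚ.< u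

fromℕ : ℕ → ℚ
fromℕ n = + n / 1

-- p ≥ x / ln n for natural p and n ≥ 2.  Since ln n > 0 and p ≥ 0, this says
-- x ≤ p · ln n, equivalently x ≤ p · u for every rational u > ln n.
_≥_/ln_ : ℕ → ℚ → ℕ → Set
p ≥ x /ln n = ∀ u → u >ln n → x ℚ.≤ fromℕ p ℚ.* u

TendsToZero : (ℕ → ℚ) → Set
TendsToZero o = ∀ ε → 0ℚ ℚ.< ε → ∃[ N ] ∀ n → N ≤ n → ℚ.∣ o n ∣ ℚ.< ε

-- p(S) ≥ (1 + o(1)) |S| / ln |S| for finite sets S, given as duplicate-free
-- lists.  Sets with |S| ≤ 1 are left out because ln |S| is not positive there.
-- A rational-valued o is no restriction: below any real sequence tending to 0
-- there is a rational one.
PolychromaticLowerBound : {A : Set} → Op₂ A → Set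
PolychromaticLowerBound {A} _∙_ =
  Σ (ℕ → ℚ) λ o → TendsToZero o ×
    (∀ (S : List A) → Unique S → 2 ≤ length S →
     ∀ p → IsPolychromaticNumber S p →
     p ≥ (1ℚ ℚ.+ o (length S)) ℚ.* fromℕ (length S) /ln length S)
  where open Polychromatic _∙_

{-# OPTIONS --safe #-}

-- For a base B exceeding twice the size of every coordinate of the vectors in S,
-- the homomorphism (x₀, …, x_{d-1}) ↦ Σᵢ xᵢ Bⁱ from ℤᵈ to ℤ is injective on S.
-- A coloring of ℤ that is polychromatic for the image of S pulls back to a
-- coloring of ℤᵈ that is polychromatic for S, and the image has |S| elements, so
-- the bound for ℤ carries over with the same o(1).
module Submission where

open import Defs
open import Algebra.Bundles using (module AbelianGroup)
open import Algebra.Core using (Op₂)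
open import Data.Integer as ℤ using (ℤ; +_; ∣_∣; 0ℤ; 1ℤ)
import Data.Integer.Properties as ℤ
open import Algebra.Properties.Group (AbelianGroup.group ℤ.+-0-abelianGroup) using (∙-cancelˡ)
open import Data.Integer.Tactic.RingSolver using (solve-∀)
open import Data.List using (List; []; _∷_; length; map; foldr; applyUpTo)
open import Data.List.Extrema.Nat using (max; xs≤max)
open import Data.List.Membership.Propositional.Properties using (∈-map⁻)
open import Data.List.Properties using (length-map)
open import Data.List.Relation.Unary.All as All using (All; []; _∷_)
import Data.List.Relation.Unary.All.Properties as All
open import Data.List.Relation.Unary.AllPairs using ([]; _∷_)
open import Data.List.Relation.Unary.Unique.Propositional using (Unique)
open import Data.Nat as ℕ using (ℕ; zero; suc; _≤_; _∸_)
open import Data.Nat.Divisibility using (divides; >⇒∤)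
import Data.Nat.Properties as ℕ
open import Data.Product using (_×_; _,_; proj₁; proj₂)
open import Data.Rational as ℚ using (ℚ; 0ℚ; 1ℚ; _/_)
import Data.Rational.Properties as ℚ
import Data.Rational.Unnormalised as ℚᵘ
import Data.Rational.Unnormalised.Properties as ℚᵘ
open import Data.Vec using ([]; _∷_)
open import Function using (_∘_)
open import Relation.Binary.PropositionalEquality
open import Relation.Nullary using (¬_)
open import Relation.Nullary.Decidable using (decidable-stable)
open import Relation.Nullary.Negation using (contradiction)

small-multiple≡0 : ∀ b x z → ∣ x ∣ ℕ.< b → x ≡ + b ℤ.* z → x ≡ 0ℤ
small-multiple≡0 b x z x<b x≡bz with ∣ x ∣ in eq
... | zero  = ℤ.∣i∣≡0⇒i≡0 eq
... | suc n = contradiction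
  (divides ∣ z ∣ (begin
    suc n          ≡⟨ eq ⟨
    ∣ x ∣          ≡⟨ cong ∣_∣ x≡bz ⟩
    ∣ + b ℤ.* z ∣  ≡⟨ ℤ.abs-* (+ b) z ⟩
    b ℕ.* ∣ z ∣    ≡⟨ ℕ.*-comm b ∣ z ∣ ⟩
    ∣ z ∣ ℕ.* b    ∎))
  (>⇒∤ x<b)
  where open ≡-Reasoning

-- Modulo the base `2m + 1` the two sides leave `x` and `y`, so `x - y` is a multiple of the base.
-- Its size is at most `2m`, hence it is zero, and cancelling leaves `a ≡ b`.
digits-unique : ∀ m x y a b → ∣ x ∣ ≤ m → ∣ y ∣ ≤ m →
                x ℤ.+ + suc (m ℕ.+ m) ℤ.* a ≡ y ℤ.+ + suc (m ℕ.+ m) ℤ.* b →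
                x ≡ y × a ≡ b
digits-unique m x y a b ∣x∣≤m ∣y∣≤m eq = x≡y , a≡b
  where
  B : ℤ
  B = + suc (m ℕ.+ m)

  difference : x ℤ.- y ≡ B ℤ.* (b ℤ.- a)
  difference = begin
    x ℤ.- y                                   ≡⟨ lemma₁ x y (B ℤ.* a) ⟩
    (x ℤ.+ B ℤ.* a) ℤ.- (y ℤ.+ B ℤ.* a)       ≡⟨ cong (ℤ._- (y ℤ.+ B ℤ.* a)) eq ⟩
    (y ℤ.+ B ℤ.* b) ℤ.- (y ℤ.+ B ℤ.* a)       ≡⟨ lemma₂ y B a b ⟩
    B ℤ.* (b ℤ.- a)                           ∎
    where
    open ≡-Reasoning
    lemma₁ : ∀ x y c → x ℤ.- y ≡ (x ℤ.+ c) ℤ.- (y ℤ.+ c)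
    lemma₁ = solve-∀
    lemma₂ : ∀ y B a b → (y ℤ.+ B ℤ.* b) ℤ.- (y ℤ.+ B ℤ.* a) ≡ B ℤ.* (b ℤ.- a)
    lemma₂ = solve-∀

  ∣x-y∣<B : ∣ x ℤ.- y ∣ ℕ.< suc (m ℕ.+ m)
  ∣x-y∣<B = ℕ.s≤s (ℕ.≤-trans (ℤ.∣i-j∣≤∣i∣+∣j∣ x y) (ℕ.+-mono-≤ ∣x∣≤m ∣y∣≤m))

  x≡y : x ≡ y
  x≡y = ℤ.i-j≡0⇒i≡j x y (small-multiple≡0 _ (x ℤ.- y) (b ℤ.- a) ∣x-y∣<B difference)

  a≡b : a ≡ b
  a≡b = ℤ.*-cancelˡ-≡ B a b
    (∙-cancelˡ y _ _ (trans (cong (ℤ._+ B ℤ.* a) (sym x≡y)) eq))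

-- Horner form of Σᵢ xᵢ Bⁱ: the lowest digit splits off, so injectivity follows by induction from
-- `digits-unique`.
evaluate : ∀ {d} → ℕ → ℤ^ d → ℤ
evaluate B []      = 0ℤ
evaluate B (x ∷ v) = x ℤ.+ + B ℤ.* evaluate B v

evaluate-+ : ∀ {d} B (v w : ℤ^ d) → evaluate B (v +ᵛ w) ≡ evaluate B v ℤ.+ evaluate B w
evaluate-+ B []      []      = refl
evaluate-+ B (x ∷ v) (y ∷ w) = begin
  x ℤ.+ y ℤ.+ + B ℤ.* evaluate B (v +ᵛ w)
    ≡⟨ cong (λ e → x ℤ.+ y ℤ.+ + B ℤ.* e) (evaluate-+ B v w) ⟩
  x ℤ.+ y ℤ.+ + B ℤ.* (evaluate B v ℤ.+ evaluate B w)
    ≡⟨ rearrange x y (+ B) (evaluate B v) (evaluate B w) ⟩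
  x ℤ.+ + B ℤ.* evaluate B v ℤ.+ (y ℤ.+ + B ℤ.* evaluate B w) ∎
  where
  open ≡-Reasoning
  rearrange : ∀ x y B a b →
    x ℤ.+ y ℤ.+ B ℤ.* (a ℤ.+ b) ≡ x ℤ.+ B ℤ.* a ℤ.+ (y ℤ.+ B ℤ.* b)
  rearrange = solve-∀

-- The sup norm.
height : ∀ {d} → ℤ^ d → ℕ
height []      = 0
height (x ∷ v) = ∣ x ∣ ℕ.⊔ height v

evaluate-injective : ∀ {d} m {v w : ℤ^ d} → height v ≤ m → height w ≤ m →
                     evaluate (suc (m ℕ.+ m)) v ≡ evaluate (suc (m ℕ.+ m)) w → v ≡ w
evaluate-injective m {[]}    {[]}    _  _  _  = refl
evaluate-injective m {x ∷ v} {y ∷ w} hv hw eq =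
  cong₂ _∷_ (proj₁ digits)
    (evaluate-injective m (ℕ.m⊔n≤o⇒n≤o ∣ x ∣ _ hv) (ℕ.m⊔n≤o⇒n≤o ∣ y ∣ _ hw) (proj₂ digits))
  where
  digits = digits-unique m x y _ _ (ℕ.m⊔n≤o⇒m≤o ∣ x ∣ _ hv) (ℕ.m⊔n≤o⇒m≤o ∣ y ∣ _ hw) eq

-- Injectivity is asked only on `P`, since `evaluate` is injective on vectors of bounded height but
-- not on all of ℤᵈ when d ≥ 2.
map-unique : ∀ {A B : Set} {P : A → Set} {f : A → B} →
             (∀ {x y} → P x → P y → f x ≡ f y → x ≡ y) →
             ∀ {xs} → All P xs → Unique xs → Unique (map f xs)
map-unique inj []         []           = []
map-unique inj (px ∷ pxs) (x∉xs ∷ xs!) =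
  All.map⁺ (All.zipWith (λ (py , x≢y) fx≡fy → x≢y (inj px py fx≡fy)) (pxs , x∉xs))
  ∷ map-unique inj pxs xs!

module _ {A B : Set} {_∙_ : Op₂ A} {_◦_ : Op₂ B} (f : A → B)
         (homo : ∀ x y → f (x ∙ y) ≡ f x ◦ f y) where

  private
    module PA = Polychromatic _∙_
    module PB = Polychromatic _◦_

  -- By the homomorphism property `f` carries the translate of `S` by `n` onto the translate of its
  -- image by `f n`, where every color occurs.
  pullback-coloring : ∀ S k → PB.HasPolychromaticColoring (map f S) k →
                      PA.HasPolychromaticColoring S k
  pullback-coloring S k (χ , poly) = χ ∘ f , poly′
    where
    poly′ : PA.IsPolychromatic S k (χ ∘ f)
    poly′ n j with poly (f n) j
    ... | t , t∈fS , χ≡j with ∈-map⁻ f t∈fS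
    ... | s , s∈S , refl = s , s∈S , trans (cong χ (homo n s)) χ≡j

  polychromaticNumber-image-≤ : ∀ S {p q} → PA.IsPolychromaticNumber S p →
                                PB.IsPolychromaticNumber (map f S) q → q ≤ p
  polychromaticNumber-image-≤ S (_ , maximal) (coloring , _) =
    maximal _ (pullback-coloring S _ coloring)

foldr-applyUpTo-nonNeg : ∀ (f : ℕ → ℚ) → (∀ i → 0ℚ ℚ.≤ f i) →
                         ∀ n → 0ℚ ℚ.≤ foldr ℚ._+_ 0ℚ (applyUpTo f n)
foldr-applyUpTo-nonNeg f f≥0 zero    = ℚ.≤-refl
foldr-applyUpTo-nonNeg f f≥0 (suc n) =
  ℚ.+-mono-≤ (f≥0 0) (foldr-applyUpTo-nonNeg (f ∘ suc) (f≥0 ∘ suc) n)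

+/-nonNeg : ∀ m n .{{_ : ℕ.NonZero n}} → 0ℚ ℚ.≤ + m / n
+/-nonNeg m n = ℚ.nonNegative⁻¹ (+ m / n) {{ℚ.normalize-nonNeg m n}}

-- The Riemann sum below `u` has nonnegative terms. The sign of `u` is what lets an inequality
-- between color counts be multiplied by `u`.
>ln⇒nonNeg : ∀ {u} n → u >ln n → 0ℚ ℚ.≤ u
>ln⇒nonNeg n (k , sum<u) = ℚ.≤-trans
  (foldr-applyUpTo-nonNeg _ (λ i → +/-nonNeg (n ∸ 1) (suc k ℕ.+ i ℕ.* (n ∸ 1))) (suc k))
  (ℚ.<⇒≤ sum<u)

fromℕ-mono-≤ : ∀ {m n} → m ≤ n → fromℕ m ℚ.≤ fromℕ n
fromℕ-mono-≤ {m} {n} m≤n = ℚ.toℚᵘ-cancel-≤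
  (ℚᵘ.≤-respˡ-≃ (ℚᵘ.≃-sym {ℚ.toℚᵘ (fromℕ m)} (toℚᵘ-fromℕ m))
    (ℚᵘ.≤-respʳ-≃ (ℚᵘ.≃-sym {ℚ.toℚᵘ (fromℕ n)} (toℚᵘ-fromℕ n))
      -- On the unreduced fractions m/1 and n/1 the order is cross-multiplication by 1.
      (ℚᵘ.*≤* (ℤ.*-monoʳ-≤-nonNeg 1ℤ (ℤ.+≤+ m≤n)))))
  where
  toℚᵘ-fromℕ : ∀ n → ℚ.toℚᵘ (fromℕ n) ℚᵘ.≃ ℚᵘ.mkℚᵘ (+ n) 0
  toℚᵘ-fromℕ n = ℚ.toℚᵘ-fromℚᵘ (ℚᵘ.mkℚᵘ (+ n) 0)

≥/ln-monoˡ : ∀ {p q} x n → q ≤ p → q ≥ x /ln n → p ≥ x /ln n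
≥/ln-monoˡ x n q≤p q≥x/ln u u>ln = ℚ.≤-trans (q≥x/ln u u>ln)
  (ℚ.*-monoʳ-≤-nonNeg u {{ℚ.nonNegative (>ln⇒nonNeg n u>ln)}} (fromℕ-mono-≤ q≤p))

-- For each `u` the claim is a decidable comparison of rationals. This permits using the
-- polychromatic number of the image, whose existence is known only under a double negation.
≥/ln-stable : ∀ p x n → ¬ ¬ (p ≥ x /ln n) → p ≥ x /ln n
≥/ln-stable p x n ¬¬p u u>ln = decidable-stable (x ℚ.≤? fromℕ p ℚ.* u)
  (λ ¬le → ¬¬p (λ h → ¬le (h u u>ln)))

theorem19 : PolychromaticLowerBound ℤ._+_ →
    (d : ℕ) → 2 ≤ d → PolychromaticLowerBound (_+ᵛ_ {d})
theorem19 (o , o→0 , bound) d _ = o , o→0 , bound′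
  where
  open Polychromatic

  bound′ : ∀ (S : List (ℤ^ d)) → Unique S → 2 ≤ length S →
           ∀ p → IsPolychromaticNumber _+ᵛ_ S p →
           p ≥ (1ℚ ℚ.+ o (length S)) ℚ.* fromℕ (length S) /ln length S
  bound′ S S! 2≤∣S∣ p p-max = ≥/ln-stable p x (length S) λ ¬goal →
    polychromaticNumber-exists ℤ._+_ 0ℤ T (ℕ.<⇒≤ 2≤∣T∣) λ (q , q-max) →
    ¬goal (≥/ln-monoˡ x (length S)
      (polychromaticNumber-image-≤ φ (evaluate-+ B) S p-max q-max)
      -- The image has as many elements as `S`, so the same value of `o` enters both bounds.
      (subst (λ n → q ≥ (1ℚ ℚ.+ o n) ℚ.* fromℕ n /ln n) (length-map φ S)
        (bound T T! 2≤∣T∣ q q-max)))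
    where
    x : ℚ
    x = (1ℚ ℚ.+ o (length S)) ℚ.* fromℕ (length S)

    -- `m` bounds every coordinate occurring in `S`. With `B` equal to `2m + 1`, the digits from -m
    -- to m are pairwise incongruent modulo `B`.
    m B : ℕ
    m = max 0 (map height S)
    B = suc (m ℕ.+ m)

    φ : ℤ^ d → ℤ
    φ = evaluate B

    T : List ℤ
    T = map φ S

    T! : Unique T
    T! = map-unique (evaluate-injective m) (All.map⁻ (xs≤max 0 (map height S))) S!

    2≤∣T∣ : 2 ≤ length T
    2≤∣T∣ = subst (2 ≤_) (sym (length-map φ S)) 2≤∣S∣
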